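{- Let $E$ be a fixed-point equation system whose interpretation restricts to a map $[\![E]\!]_{\le 1}\colon\mathbb{E}_{\le 1}(D)\to\mathbb{E}_{\le 1}(D)$. Then for every $d\in D$ and every $\epsilon>0$ there exists $\eta'\in\mathbb{E}(D)$ with $\mu[\![E]\!]_{\le 1}(d)-\epsilon<\eta'(d)\le\mu[\![E]\!]_{\le 1}(d)$ such that there exist: a fixed-point equation system $E'$ over the same predicate variables with $[\![E']\!]\le[\![E]\!]$; $u\in\mathbb{E}(D)$ with $[\![E']\!](u)\le u$; a function $r\colon D\to[0,\infty)$ with $(\mathsf{D}[\![E']\!])(r)+u\le r$; and such that $\eta'\le u$ and $\eta'\le[\![E']\!](\eta')$.
   Context: $\mathbb{E}(D)$ is the set of functions $D\to[0,\infty]$ with pointwise order and operations ($\infty+x=\infty$, $0\cdot\infty=0$, $r\cdot\infty=\infty$ for $r>0$); $\mathbb{E}_{\le 1}(D)$ is the subset of functions $D\to[0,1]$; for $x\ge y$ in $[0,\infty]$, $x-y$ is the least $z$ with $x=y+z$; $\mathbb{O}$ is the zero function; $(\mathsf{D}K)(\eta)=K(\eta)-K(\mathbb{O})$; $\mu$ denotes least fixed point. Quantitative formulas over predicate variables $X_1,\dots,X_n$ ($X_j$ of type $D_j\to\Omega$): $F ::= X_j(\tilde e)\mid t\mid F_1+F_2\mid t\cdot F\mid \mathbf{if}\ \varphi\ \mathbf{then}\ F_1\ \mathbf{else}\ F_2$ with $\tilde e$ expressions, $t$ a $[0,\infty)$-valued term, $\varphi$ boolean; interpreted by $[\![X_j(e)]\!](\eta)(v)=\eta_j([\![e]\!](v))$,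 $[\![t]\!](\eta)(v)=[\![t]\!](v)$, pointwise sum and scalar product, case distinction for conditionals. A fixed-point equation system $E=\{X_i(\tilde x_i)=_\mu F_i\}_{i=1}^n$ has interpretation $[\![E]\!](\eta)=([\![F_1]\!](\eta),\dots,[\![F_n]\!](\eta))$ on $\mathbb{E}(D)$, $D=\coprod_j D_j$. (The existence of the data $E',u,r$ with the stated conditions is what the paper calls provability of $\eta'\le\mu[\![E]\!]$ by its proof rule.) -}

module Defs where

open import Level using (Level; Lift; lift; lower; _⊔_; 0ℓ) renaming (suc to lsuc)
open import Data.Bool using (Bool; if_then_else_)
open import Data.Fin using (Fin)
open import Data.Nat using (ℕ)
open import Data.Product using (Σ; Σ-syntax; ∃; ∃-syntax; _×_; _,_; proj₁; proj₂)
open import Data.Rational as ℚ using (ℚ; 0ℚ; 1ℚ; NonNegative)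
import Data.Rational.Properties as ℚₚ
open import Data.Sum using (_⊎_; inj₁; inj₂)
open import Function using (_∘_)
open import Relation.Nullary using (¬_)
open import Relation.Binary.PropositionalEquality using (_≡_; refl; sym; trans; cong; subst)

-- The extended non-negative reals [0,∞]: x is given by its lower cut { q ∈ ℚ ∣ q < x }.  The cut need not be
-- bounded: all of ℚ is ∞.  Every negative rational belongs to it, so
-- that 0 is the least element.  Classically these are exactly the
-- elements of [0,∞].
record ℝ≥0∞ : Set₁ where
  field
    below    : ℚ → Set
    negative : ∀ {q} → q ℚ.< 0ℚ → below q
    down     : ∀ {p q} → p ℚ.< q → below q → below p
    open′    : ∀ {p} → below p → ∃[ q ] p ℚ.< q × below q

open ℝ≥0∞ public

infix 4 _≤_ _≈_ _<_
infixl 6 _+_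
infixl 7 _*_

_≤_ : ℝ≥0∞ → ℝ≥0∞ → Set
x ≤ y = ∀ q → below x q → below y q

_≈_ : ℝ≥0∞ → ℝ≥0∞ → Set
x ≈ y = x ≤ y × y ≤ x

_<_ : ℝ≥0∞ → ℝ≥0∞ → Set
x < y = ∃[ q ] below y q × ¬ below x q

Finite : ℝ≥0∞ → Set
Finite x = ∃[ q ] ¬ below x q

-- [0,∞)
ℝ≥0 : Set₁
ℝ≥0 = Σ ℝ≥0∞ Finite

fromℚ : (q : ℚ) → .{{NonNegative q}} → ℝ≥0∞
fromℚ q .below p         = p ℚ.< q
fromℚ q .negative p<0    = ℚₚ.<-≤-trans p<0 (ℚₚ.nonNegative⁻¹ q)
fromℚ q .down p<p′ p′<q  = ℚₚ.<-trans p<p′ p′<q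
fromℚ q .open′ p<q       = let m , p<m , m<q = ℚₚ.<-dense p<q in m , p<m , m<q

fromℚ-finite : (q : ℚ) → .{{_ : NonNegative q}} → Finite (fromℚ q)
fromℚ-finite q = q , ℚₚ.<-irrefl refl

𝟎 𝟏 : ℝ≥0∞
𝟎 = fromℚ 0ℚ
𝟏 = fromℚ 1ℚ

_+_ : ℝ≥0∞ → ℝ≥0∞ → ℝ≥0∞
(x + y) .below q = ∃[ a ] ∃[ b ] below x a × below y b × q ℚ.≤ a ℚ.+ b
(x + y) .negative {q} q<0 =
  let m , q<m , m<0 = ℚₚ.<-dense q<0
      q-m<0 = subst (q ℚ.- m ℚ.<_) (ℚₚ.+-inverseʳ m) (ℚₚ.+-monoˡ-< (ℚ.- m) q<m)
      q≡ = sym (trans (ℚₚ.+-comm m (q ℚ.- m))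
               (trans (ℚₚ.+-assoc q (ℚ.- m) m)
               (trans (cong (q ℚ.+_) (ℚₚ.+-inverseˡ m)) (ℚₚ.+-identityʳ q))))
  in  m , q ℚ.- m , negative x m<0 , negative y q-m<0 , ℚₚ.≤-reflexive q≡
(x + y) .down p<q (a , b , a∈ , b∈ , q≤) =
  a , b , a∈ , b∈ , ℚₚ.≤-trans (ℚₚ.<⇒≤ p<q) q≤
(x + y) .open′ (a , b , a∈ , b∈ , p≤) =
  let a′ , a<a′ , a′∈ = open′ x a∈
  in  a′ ℚ.+ b , ℚₚ.≤-<-trans p≤ (ℚₚ.+-monoˡ-< b a<a′) , a′ , b , a′∈ , b∈ , ℚₚ.≤-refl

-- No non-negative rational lies below 0, so 0 * ∞ is 0.
_*_ : ℝ≥0∞ → ℝ≥0∞ → ℝ≥0∞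
(x * y) .below q = q ℚ.< 0ℚ ⊎
  (∃[ a ] ∃[ b ] below x a × below y b × 0ℚ ℚ.≤ a × 0ℚ ℚ.≤ b × q ℚ.< a ℚ.* b)
(x * y) .negative = inj₁
(x * y) .down p<q (inj₁ q<0) = inj₁ (ℚₚ.<-trans p<q q<0)
(x * y) .down p<q (inj₂ (a , b , a∈ , b∈ , 0≤a , 0≤b , q<)) =
  inj₂ (a , b , a∈ , b∈ , 0≤a , 0≤b , ℚₚ.<-trans p<q q<)
(x * y) .open′ (inj₁ p<0) =
  let m , p<m , m<0 = ℚₚ.<-dense p<0 in m , p<m , inj₁ m<0
(x * y) .open′ (inj₂ (a , b , a∈ , b∈ , 0≤a , 0≤b , p<)) =
  let m , p<m , m< = ℚₚ.<-dense p<
  in  m , p<m , inj₂ (a , b , a∈ , b∈ , 0≤a , 0≤b , m<)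

-- z is x - y: the least z with x = y + z.  Such a z exists exactly when
-- y ≤ x, so subtraction is given by its graph.
IsDifference : ℝ≥0∞ → ℝ≥0∞ → ℝ≥0∞ → Set₁
IsDifference x y z = x ≈ y + z × (∀ z′ → x ≈ y + z′ → z ≤ z′)

𝔼 : ∀ {a} → Set a → Set (a ⊔ lsuc 0ℓ)
𝔼 X = X → ℝ≥0∞

module _ {a} {X : Set a} where

  infix 4 _⊑_
  infixl 6 _∔_

  _⊑_ : 𝔼 X → 𝔼 X → Set a
  η ⊑ θ = ∀ x → η x ≤ θ x

  _∔_ : 𝔼 X → 𝔼 X → 𝔼 X
  (η ∔ θ) x = η x + θ x

  𝕆 𝟙 : 𝔼 X
  𝕆 _ = 𝟎
  𝟙 _ = 𝟏

  -- δ is (𝖣 K)(η) = K(η) - K(𝕆).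
  IsDifferential : (𝔼 X → 𝔼 X) → 𝔼 X → 𝔼 X → Set (a ⊔ lsuc 0ℓ)
  IsDifferential K η δ = ∀ x → IsDifference (K η x) (K 𝕆 x) (δ x)

𝔼≤1 : ∀ {a} → Set a → Set (a ⊔ lsuc 0ℓ)
𝔼≤1 X = Σ[ η ∈ 𝔼 X ] η ⊑ 𝟙

module _ {a} {X : Set a} where

  infix 4 _⊑₁_

  _⊑₁_ : 𝔼≤1 X → 𝔼≤1 X → Set a
  η ⊑₁ θ = proj₁ η ⊑ proj₁ θ

  Restricts : (𝔼 X → 𝔼 X) → Set (a ⊔ lsuc 0ℓ)
  Restricts K = ∀ η → η ⊑ 𝟙 → K η ⊑ 𝟙

  restrict : (K : 𝔼 X → 𝔼 X) → Restricts K → 𝔼≤1 X → 𝔼≤1 X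
  restrict K K≤1 (η , η≤1) = K η , K≤1 η η≤1

-- Equality is the one induced by the order.
record IsLeastFixedPoint {a ℓ} {A : Set a} (_≼_ : A → A → Set ℓ)
                         (f : A → A) (m : A) : Set (a ⊔ ℓ) where
  field
    fixed : f m ≼ m × m ≼ f m
    least : ∀ x → f x ≼ x × x ≼ f x → m ≼ x

-- The languages of expressions, terms and boolean conditions, over a
-- variable x̃ᵢ ranging over D i, are arbitrary interpreted languages;
-- terms are only required to include the non-negative rational constants.
record Language {a} {n : ℕ} (D : Fin n → Set a) (ℓ : Level) :
                Set (a ⊔ lsuc (lsuc 0ℓ) ⊔ lsuc ℓ) where
  field
    Expr : Fin n → Fin n → Set ℓ
    Term : Fin n → Set ℓ
    Test : Fin n → Set ℓ
    expr : ∀ {i j} → Expr i j → D i → D j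
    term : ∀ {i} → Term i → D i → ℝ≥0
    test : ∀ {i} → Test i → D i → Bool
    const   : ∀ {i} (q : ℚ) → .{{NonNegative q}} → Term i
    const-≈ : ∀ {i} (q : ℚ) .{{_ : NonNegative q}} (v : D i) →
              proj₁ (term (const q) v) ≈ fromℚ q

-- The purely semantic choice: all functions are allowed.
allFunctions : ∀ {a n} (D : Fin n → Set a) → Language D (a ⊔ lsuc 0ℓ)
allFunctions {a} D = record
  { Expr = λ i j → Lift (a ⊔ lsuc 0ℓ) (D i → D j)
  ; Term = λ i → D i → ℝ≥0
  ; Test = λ i → Lift (a ⊔ lsuc 0ℓ) (D i → Bool)
  ; expr = lower
  ; term = λ t → t
  ; test = lower
  ; const = λ q _ → fromℚ q , fromℚ-finite q
  ; const-≈ = λ q v → (λ _ p → p) , (λ _ p → p)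
  }

module Systems {a ℓ} {n : ℕ} {D : Fin n → Set a} (L : Language D ℓ) where
  open Language L

  -- Formulas whose only variable is x̃ᵢ.
  data Formula (i : Fin n) : Set ℓ where
    call : (j : Fin n) → Expr i j → Formula i
    ⌜_⌝  : Term i → Formula i
    _⊞_  : Formula i → Formula i → Formula i
    _⊡_  : Term i → Formula i → Formula i
    cond : Test i → Formula i → Formula i → Formula i

  ∐D : Set a
  ∐D = Σ (Fin n) D

  ⟦_⟧ᶠ : ∀ {i} → Formula i → 𝔼 ∐D → 𝔼 (D i)
  ⟦ call j e ⟧ᶠ   η v = η (j , expr e v)
  ⟦ ⌜ t ⌝ ⟧ᶠ      η v = proj₁ (term t v)
  ⟦ F ⊞ G ⟧ᶠ      η v = ⟦ F ⟧ᶠ η v + ⟦ G ⟧ᶠ η v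
  ⟦ t ⊡ F ⟧ᶠ      η v = proj₁ (term t v) * ⟦ F ⟧ᶠ η v
  ⟦ cond φ F G ⟧ᶠ η v = if test φ v then ⟦ F ⟧ᶠ η v else ⟦ G ⟧ᶠ η v

  System : Set ℓ
  System = (i : Fin n) → Formula i

  ⟦_⟧ : System → 𝔼 ∐D → 𝔼 ∐D
  ⟦ E ⟧ η (i , v) = ⟦ E i ⟧ᶠ η v

  -- Provability of η′ ≤ μ ⟦ E ⟧.
  record Provable (E : System) (η′ : 𝔼 ∐D) : Set (a ⊔ ℓ ⊔ lsuc 0ℓ) where
    field
      E′       : System
      E′≤E     : ∀ η → ⟦ E′ ⟧ η ⊑ ⟦ E ⟧ η
      u        : 𝔼 ∐D
      prefixed : ⟦ E′ ⟧ u ⊑ u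
      r        : ∐D → ℝ≥0
      ranking  : ∃[ δ ] IsDifferential ⟦ E′ ⟧ (proj₁ ∘ r) δ × δ ∔ u ⊑ proj₁ ∘ r
      η′≤u     : η′ ⊑ u
      postfixed : η′ ⊑ ⟦ E′ ⟧ η′

{-# OPTIONS --safe #-}
module Submission where

-- Let cₖ = 1 - 2⁻ᵏ and Eₖ = cₖ · E, so that Eₖ ≤ E.  Every formula is affine
-- in its variables, and the linear part 𝖣 E maps the constant 1 below 1.
-- Hence 𝖣 Eₖ contracts constants by cₖ, and as cₖ 2ᵏ + 1 = 2ᵏ, the constant
-- r = 2ᵏ is a ranking function for u = 1.  The iterates xₖ = Eₖᵏ(𝕆) are
-- therefore provable; they ascend, and by ω-continuity their supremum is a
-- fixed point of E, so it lies above μ E and some xₖ is ε-close to it at d.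

open import Axiom.ExcludedMiddle using (ExcludedMiddle)
open import Data.Bool using (true; false; if_then_else_)
open import Data.Fin using (Fin)
import Data.Integer as ℤ
import Data.Integer.Properties as ℤₚ
open import Data.Nat as ℕ using (ℕ; zero; suc)
import Data.Nat.Properties as ℕₚ
open import Data.Product using (Σ-syntax; ∃-syntax; _×_; _,_; proj₁; proj₂)
open import Data.Rational as ℚ using (ℚ; mkℚ; 0ℚ; 1ℚ; ½; NonNegative; Positive)
import Data.Rational.Properties as ℚₚ
open import Data.Rational.Solver using (module +-*-Solver)
import Data.Rational.Unnormalised as ℚᵘ
import Data.Rational.Unnormalised.Properties as ℚᵘₚ
open import Data.Sum using (inj₁; inj₂)
open import Function using (_∘_)
open import Level using (Level; 0ℓ)
open import Relation.Binary.PropositionalEquality using (_≡_; refl; sym; trans; cong; cong₂; subst; subst₂)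
open import Relation.Nullary using (¬_; yes; no)
open import Defs

open +-*-Solver using (solve; con; _:=_; _:+_; _:*_; _:-_)

-- Rational arithmetic

p≡p-q+q : ∀ p q → p ≡ (p ℚ.- q) ℚ.+ q
p≡p-q+q = solve 2 (λ p q → p := (p :- q) :+ q) refl

p+q-q≡p : ∀ p q → (p ℚ.+ q) ℚ.- q ≡ p
p+q-q≡p = solve 2 (λ p q → (p :+ q) :- q := p) refl

p<q+r⇒p-r<q : ∀ p q r → p ℚ.< q ℚ.+ r → p ℚ.- r ℚ.< q
p<q+r⇒p-r<q p q r p<q+r =
  subst (p ℚ.- r ℚ.<_) (p+q-q≡p q r) (ℚₚ.+-monoˡ-< (ℚ.- r) p<q+r)

p<q⇒p-q<0 : ∀ p q → p ℚ.< q → p ℚ.- q ℚ.< 0ℚ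
p<q⇒p-q<0 p q p<q = p<q+r⇒p-r<q p 0ℚ q (subst (p ℚ.<_) (sym (ℚₚ.+-identityˡ q)) p<q)

p<q⇒0<q-p : ∀ p q → p ℚ.< q → 0ℚ ℚ.< q ℚ.- p
p<q⇒0<q-p p q p<q =
  subst (ℚ._< q ℚ.- p) (ℚₚ.+-inverseʳ p) (ℚₚ.+-monoˡ-< (ℚ.- p) p<q)

+-cancelʳ-< : ∀ r {p q} → p ℚ.+ r ℚ.< q ℚ.+ r → p ℚ.< q
+-cancelʳ-< r {p} {q} p+r<q+r =
  subst (ℚ._< q) (p+q-q≡p p r) (p<q+r⇒p-r<q (p ℚ.+ r) q r p+r<q+r)

-- Membership in a sum of cuts asks for such a pair. Any `a` strictly between `q - v` and `u` works,
-- with `q - a` as the other summand.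
<-split : ∀ {q u v} → q ℚ.< u ℚ.+ v →
          ∃[ a ] ∃[ b ] a ℚ.< u × b ℚ.< v × q ℚ.≤ a ℚ.+ b
<-split {q} {u} {v} q<u+v =
  let a , q-v<a , a<u = ℚₚ.<-dense (p<q+r⇒p-r<q q u v q<u+v)
      q<v+a = subst₂ ℚ._<_ (sym (p≡p-q+q q v)) (ℚₚ.+-comm a v) (ℚₚ.+-monoˡ-< v q-v<a)
  in  a , q ℚ.- a , a<u , p<q+r⇒p-r<q q v a q<v+a ,
      ℚₚ.≤-reflexive (trans (p≡p-q+q q a) (ℚₚ.+-comm (q ℚ.- a) a))

-- Powers of two and the Archimedean property

2^ : ℕ → ℚ
2^ zero    = 1ℚ
2^ (suc k) = 2^ k ℚ.+ 2^ k

2^-positive : ∀ k → Positive (2^ k)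
2^-positive zero    = _
2^-positive (suc k) =
  let instance 2^k>0 = 2^-positive k in ℚₚ.pos+pos⇒pos (2^ k) (2^ k)

2^-nonNegative : ∀ k → NonNegative (2^ k)
2^-nonNegative k = ℚₚ.pos⇒nonNeg (2^ k) {{2^-positive k}}

n<2^n : ∀ n → n ℕ.< 2 ℕ.^ n
n<2^n zero    = ℕ.s≤s ℕ.z≤n
n<2^n (suc n) = begin
  1 ℕ.+ suc n           ≤⟨ ℕₚ.+-mono-≤ (ℕₚ.≤-trans (ℕ.s≤s ℕ.z≤n) (n<2^n n)) (n<2^n n) ⟩
  2 ℕ.^ n ℕ.+ 2 ℕ.^ n   ≡⟨ cong (2 ℕ.^ n ℕ.+_) (sym (ℕₚ.+-identityʳ (2 ℕ.^ n))) ⟩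
  2 ℕ.^ suc n           ∎
  where open ℕₚ.≤-Reasoning

toℚᵘ-2^ : ∀ k → ℚ.toℚᵘ (2^ k) ℚᵘ.≃ ℚᵘ.mkℚᵘ (ℤ.+ (2 ℕ.^ k)) 0
toℚᵘ-2^ zero    = ℚᵘₚ.≃-refl
toℚᵘ-2^ (suc k) = ℚᵘₚ.≃-trans (ℚₚ.toℚᵘ-homo-+ (2^ k) (2^ k))
  (ℚᵘₚ.≃-trans (ℚᵘₚ.+-cong (toℚᵘ-2^ k) (toℚᵘ-2^ k)) (ℚᵘₚ.≃-reflexive (cong (λ z → ℚᵘ.mkℚᵘ z 0) double)))
  where
  n = 2 ℕ.^ k
  double : (ℤ.+ n) ℤ.* ℤ.1ℤ ℤ.+ (ℤ.+ n) ℤ.* ℤ.1ℤ ≡ ℤ.+ (2 ℕ.^ suc k)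
  double = trans (cong₂ ℤ._+_ (ℤₚ.*-identityʳ (ℤ.+ n)) (ℤₚ.*-identityʳ (ℤ.+ n)))
                 (cong (λ j → ℤ.+ (n ℕ.+ j)) (sym (ℕₚ.+-identityʳ n)))

-- A non-negative fraction is at most its numerator `n`, and `n` is less than the `n`-th power of
-- two. A negative one is already below `2^ 0`.
2^-unbounded : ∀ p → ∃[ k ] p ℚ.< 2^ k
2^-unbounded p@(mkℚ ℤ.-[1+ _ ] _ _) = 0 , ℚₚ.<-trans (ℚₚ.negative⁻¹ p) (ℚₚ.positive⁻¹ 1ℚ)
2^-unbounded p@(mkℚ (ℤ.+ n) d _) = n , ℚₚ.toℚᵘ-cancel-<
  (ℚᵘₚ.<-respʳ-≃ (ℚᵘₚ.≃-sym (toℚᵘ-2^ n)) (ℚᵘ.*<* (subst₂ ℤ._<_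
    (sym (ℤₚ.*-identityʳ (ℤ.+ n))) (ℤₚ.pos-* (2 ℕ.^ n) (suc d))
    (ℤ.+<+ (ℕₚ.<-≤-trans (n<2^n n) (ℕₚ.m≤m*n (2 ℕ.^ n) (suc d)))))))

archimedean : ∀ p e → 0ℚ ℚ.< e → ∃[ k ] p ℚ.< 2^ k ℚ.* e
archimedean p e 0<e =
  let k , p/e<2^k = 2^-unbounded (p ℚ.* 1/e)
  in  k , subst (ℚ._< 2^ k ℚ.* e) cancel (ℚₚ.*-monoˡ-<-pos e p/e<2^k)
  where
  instance
    e>0 = ℚ.positive 0<e
    e≢0 = ℚₚ.pos⇒nonZero e
  1/e = ℚ.1/ e
  cancel : p ℚ.* 1/e ℚ.* e ≡ p
  cancel = trans (ℚₚ.*-assoc p 1/e e) (trans (cong (p ℚ.*_) (ℚₚ.*-inverseˡ e)) (ℚₚ.*-identityʳ p))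

-- The contraction factors

-- 1 - 2⁻ᵏ.
contraction : ℕ → ℚ
contraction zero    = 0ℚ
contraction (suc k) = ½ ℚ.* (contraction k ℚ.+ 1ℚ)

-- This division-free form of cₖ = 1 - 2⁻ᵏ is what makes 2ᵏ a ranking constant. Halving cₖ + 1
-- cancels against doubling 2ᵏ.
contraction-2^ : ∀ k → contraction k ℚ.* 2^ k ℚ.+ 1ℚ ≡ 2^ k
contraction-2^ zero    = refl
contraction-2^ (suc k) =
  trans (solve 2 (λ c r → con ½ :* (c :+ con 1ℚ) :* (r :+ r) :+ con 1ℚ
                       := (c :* r :+ con 1ℚ) :+ r) refl (contraction k) (2^ k))
        (cong (ℚ._+ 2^ k) (contraction-2^ k))

contraction≤1 : ∀ k → contraction k ℚ.≤ 1ℚ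
contraction≤1 zero    = ℚₚ.nonNegative⁻¹ 1ℚ
contraction≤1 (suc k) = ℚₚ.*-monoˡ-≤-nonNeg ½ (ℚₚ.+-monoˡ-≤ 1ℚ (contraction≤1 k))

contraction-ascending : ∀ k → contraction k ℚ.≤ contraction (suc k)
contraction-ascending k =
  subst (ℚ._≤ contraction (suc k))
        (solve 1 (λ c → con ½ :* (c :+ c) := c) refl c)
        (ℚₚ.*-monoˡ-≤-nonNeg ½ (ℚₚ.+-monoʳ-≤ c (contraction≤1 k)))
  where c = contraction k

contraction-nonNegative : ∀ k → NonNegative (contraction k)
contraction-nonNegative k = ℚ.nonNegative (0≤ k)
  where
  0≤ : ∀ k → 0ℚ ℚ.≤ contraction k
  0≤ zero    = ℚₚ.≤-refl
  0≤ (suc k) = ℚₚ.≤-trans (0≤ k) (contraction-ascending k)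

-- If q < 2ᵏ (q - p), then p 2ᵏ < q 2ᵏ - q = cₖ q 2ᵏ, and 2ᵏ cancels.
contraction-dense : ∀ p q → 0ℚ ℚ.< q → p ℚ.< q → ∃[ k ] p ℚ.< contraction k ℚ.* q
contraction-dense p q 0<q p<q =
  let k , q<2^k*[q-p] = archimedean q (q ℚ.- p) (p<q⇒0<q-p p q p<q)
      instance 2^k≥0 = 2^-nonNegative k
      c = contraction k
      r = 2^ k
      eq : r ℚ.* (q ℚ.- p) ℚ.+ p ℚ.* r ≡ c ℚ.* q ℚ.* r ℚ.+ q
      eq = trans (solve 3 (λ p q r → r :* (q :- p) :+ p :* r := r :* q) refl p q r)
          (trans (cong (ℚ._* q) (sym (contraction-2^ k)))
                 (solve 3 (λ c q r → (c :* r :+ con 1ℚ) :* q := c :* q :* r :+ q) refl c q r))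
  in  k , ℚₚ.*-cancelʳ-<-nonNeg r (+-cancelʳ-< q
            (subst₂ ℚ._<_ (ℚₚ.+-comm q (p ℚ.* r)) eq (ℚₚ.+-monoˡ-< (p ℚ.* r) q<2^k*[q-p])))

-- Order, sums and products in [0,∞]

down-≤ : ∀ x {p q} → p ℚ.≤ q → below x q → below x p
down-≤ x p≤q q∈ = let q′ , q<q′ , q′∈ = open′ x q∈ in down x (ℚₚ.≤-<-trans p≤q q<q′) q′∈

below⇒< : ∀ x {p q} → below x p → ¬ below x q → p ℚ.< q
below⇒< x p∈ q∉ = ℚₚ.≰⇒> (λ q≤p → q∉ (down-≤ x q≤p p∈))

𝟎-least : ∀ x → 𝟎 ≤ x
𝟎-least x _ = negative x

fromℚ-mono : ∀ p q .{{_ : NonNegative p}} .{{_ : NonNegative q}} → p ℚ.≤ q → fromℚ p ≤ fromℚ q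
fromℚ-mono p q p≤q _ s<p = ℚₚ.<-≤-trans s<p p≤q

fromℚ-+-≤ : ∀ p q s .{{_ : NonNegative p}} .{{_ : NonNegative q}} .{{_ : NonNegative s}} →
            p ℚ.+ q ≡ s → fromℚ p + fromℚ q ≤ fromℚ s
fromℚ-+-≤ p q s p+q≡s t (a , b , a<p , b<q , t≤a+b) =
  ℚₚ.≤-<-trans t≤a+b (subst (a ℚ.+ b ℚ.<_) p+q≡s (ℚₚ.+-mono-< a<p b<q))

fromℚ-+-≥ : ∀ p q s .{{_ : NonNegative p}} .{{_ : NonNegative q}} .{{_ : NonNegative s}} →
            p ℚ.+ q ≡ s → fromℚ s ≤ fromℚ p + fromℚ q
fromℚ-+-≥ p q s p+q≡s t t<s = <-split (subst (t ℚ.<_) (sym p+q≡s) t<s)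

-- The route through `a * d` leaves the sign of `b` free, and `*-below` applies it to a negative
-- `b`.
*-mono-≤-nonNeg : ∀ {a b c d} → 0ℚ ℚ.≤ a → 0ℚ ℚ.≤ d → a ℚ.≤ c → b ℚ.≤ d → a ℚ.* b ℚ.≤ c ℚ.* d
*-mono-≤-nonNeg {a} {b} {c} {d} 0≤a 0≤d a≤c b≤d = ℚₚ.≤-trans
  (ℚₚ.*-monoˡ-≤-nonNeg a {{ℚ.nonNegative 0≤a}} b≤d)
  (ℚₚ.*-monoʳ-≤-nonNeg d {{ℚ.nonNegative 0≤d}} a≤c)

fromℚ-*-≤ : ∀ p q s .{{_ : NonNegative p}} .{{_ : NonNegative q}} .{{_ : NonNegative s}} →
            p ℚ.* q ≡ s → fromℚ p * fromℚ q ≤ fromℚ s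
fromℚ-*-≤ p q s p*q≡s t (inj₁ t<0) = 𝟎-least (fromℚ s) t t<0
fromℚ-*-≤ p q s p*q≡s t (inj₂ (a , b , a<p , b<q , 0≤a , 0≤b , t<a*b)) =
  ℚₚ.<-≤-trans t<a*b (subst (a ℚ.* b ℚ.≤_) p*q≡s
    (*-mono-≤-nonNeg 0≤a (ℚₚ.nonNegative⁻¹ q) (ℚₚ.<⇒≤ a<p) (ℚₚ.<⇒≤ b<q)))

+-mono : ∀ x x′ y y′ → x ≤ x′ → y ≤ y′ → x + y ≤ x′ + y′
+-mono x x′ y y′ x≤x′ y≤y′ q (a , b , a∈ , b∈ , q≤) = a , b , x≤x′ a a∈ , y≤y′ b b∈ , q≤

-- Every cut contains the negative rationals, so `y` can supply the difference from a larger member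
-- `q′` of `x` down to `q`.
x≤y+x : ∀ x y → x ≤ y + x
x≤y+x x y q q∈ =
  let q′ , q<q′ , q′∈ = open′ x q∈
  in  q ℚ.- q′ , q′ , negative y (p<q⇒p-q<0 q q′ q<q′) , q′∈ , ℚₚ.≤-reflexive (p≡p-q+q q q′)

+-comm-≤ : ∀ x y → x + y ≤ y + x
+-comm-≤ x y q (a , b , a∈ , b∈ , q≤) = b , a , b∈ , a∈ , subst (q ℚ.≤_) (ℚₚ.+-comm a b) q≤

x≤x+y : ∀ x y → x ≤ x + y
x≤x+y x y q q∈ = +-comm-≤ y x q (x≤y+x x y q q∈)

𝟎+x≤x : ∀ x → 𝟎 + x ≤ x
𝟎+x≤x x q (a , b , a<0 , b∈ , q≤a+b) =
  down-≤ x (ℚₚ.≤-trans q≤a+b (subst (a ℚ.+ b ℚ.≤_) (ℚₚ.+-identityˡ b) (ℚₚ.+-monoˡ-≤ b (ℚₚ.<⇒≤ a<0)))) b∈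

x+𝟎≤x : ∀ x → x + 𝟎 ≤ x
x+𝟎≤x x q q∈ = 𝟎+x≤x x q (+-comm-≤ x 𝟎 q q∈)

+-interchange-≤ : ∀ x y z w → (x + y) + (z + w) ≤ (x + z) + (y + w)
+-interchange-≤ x y z w q (p , p′ , (a , b , a∈ , b∈ , p≤) , (c , d , c∈ , d∈ , p′≤) , q≤) =
  a ℚ.+ c , b ℚ.+ d , (a , c , a∈ , c∈ , ℚₚ.≤-refl) , (b , d , b∈ , d∈ , ℚₚ.≤-refl) ,
  ℚₚ.≤-trans q≤ (ℚₚ.≤-trans (ℚₚ.+-mono-≤ p≤ p′≤) (ℚₚ.≤-reflexive
    (solve 4 (λ a b c d → (a :+ b) :+ (c :+ d) := (a :+ c) :+ (b :+ d)) refl a b c d)))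

*-mono : ∀ x x′ y y′ → x ≤ x′ → y ≤ y′ → x * y ≤ x′ * y′
*-mono x x′ y y′ x≤x′ y≤y′ q (inj₁ q<0) = inj₁ q<0
*-mono x x′ y y′ x≤x′ y≤y′ q (inj₂ (a , b , a∈ , b∈ , rest)) =
  inj₂ (a , b , x≤x′ a a∈ , y≤y′ b b∈ , rest)

≤𝟏⇒*-≤ : ∀ t x → t ≤ 𝟏 → t * x ≤ x
≤𝟏⇒*-≤ t x t≤1 q (inj₁ q<0) = negative x q<0
≤𝟏⇒*-≤ t x t≤1 q (inj₂ (a , b , a∈ , b∈ , 0≤a , 0≤b , q<a*b)) =
  down-≤ x (ℚₚ.≤-trans (ℚₚ.<⇒≤ q<a*b)
    (subst (a ℚ.* b ℚ.≤_) (ℚₚ.*-identityˡ b)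
      (*-mono-≤-nonNeg 0≤a 0≤b (ℚₚ.<⇒≤ (t≤1 a a∈)) ℚₚ.≤-refl))) b∈

-- The factor b of a product may be replaced by max(b, 0): this is what
-- distributivity needs, as cuts contain negative rationals.
*-below : ∀ t x {a b} → below t a → below x b → 0ℚ ℚ.≤ a →
          ∃[ u ] a ℚ.* b ℚ.≤ u × (∀ p → p ℚ.< u → below (t * x) p)
*-below t x {a} {b} a∈ b∈ 0≤a with 0ℚ ℚ.≤? b
... | yes 0≤b = a ℚ.* b , ℚₚ.≤-refl , λ p p<a*b → inj₂ (a , b , a∈ , b∈ , 0≤a , 0≤b , p<a*b)
... | no 0≰b  = 0ℚ ,
  subst (a ℚ.* b ℚ.≤_) (ℚₚ.*-zeroʳ a)
    (*-mono-≤-nonNeg 0≤a ℚₚ.≤-refl ℚₚ.≤-refl (ℚₚ.<⇒≤ (ℚₚ.≰⇒> 0≰b))) ,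
  λ p p<0 → inj₁ p<0

*-distribˡ-+-≤ : ∀ t x y → t * (x + y) ≤ t * x + t * y
*-distribˡ-+-≤ t x y q (inj₁ q<0) = negative (t * x + t * y) q<0
*-distribˡ-+-≤ t x y q (inj₂ (a , b , a∈ , (b₁ , b₂ , b₁∈ , b₂∈ , b≤) , 0≤a , 0≤b , q<a*b)) =
  let u₁ , ab₁≤u₁ , <u₁⇒∈ = *-below t x a∈ b₁∈ 0≤a
      u₂ , ab₂≤u₂ , <u₂⇒∈ = *-below t y a∈ b₂∈ 0≤a
      a*b≤u₁+u₂ = ℚₚ.≤-trans (ℚₚ.*-monoˡ-≤-nonNeg a {{ℚ.nonNegative 0≤a}} b≤)
                 (ℚₚ.≤-trans (ℚₚ.≤-reflexive (ℚₚ.*-distribˡ-+ a b₁ b₂))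
                             (ℚₚ.+-mono-≤ ab₁≤u₁ ab₂≤u₂))
      p₁ , p₂ , p₁<u₁ , p₂<u₂ , q≤ = <-split (ℚₚ.<-≤-trans q<a*b a*b≤u₁+u₂)
  in  p₁ , p₂ , <u₁⇒∈ p₁ p₁<u₁ , <u₂⇒∈ p₂ p₂<u₂ , q≤

-- A product that contributes only a negative rational acts as `𝟎`, and the other product then
-- suffices.
*-distribˡ-+-≥ : ∀ t x y → t * x + t * y ≤ t * (x + y)
*-distribˡ-+-≥ t x y q (p₁ , p₂ , inj₁ p₁<0 , p₂∈ , q≤) =
  *-mono t t y (x + y) (λ _ a∈ → a∈) (x≤y+x y x) q
    (𝟎+x≤x (t * y) q (p₁ , p₂ , p₁<0 , p₂∈ , q≤))
*-distribˡ-+-≥ t x y q (p₁ , p₂ , p₁∈ , inj₁ p₂<0 , q≤) =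
  *-mono t t x (x + y) (λ _ a∈ → a∈) (x≤x+y x y) q
    (x+𝟎≤x (t * x) q (p₁ , p₂ , p₁∈ , p₂<0 , q≤))
*-distribˡ-+-≥ t x y q
  ( p₁ , p₂ , inj₂ (a₁ , b₁ , a₁∈ , b₁∈ , 0≤a₁ , 0≤b₁ , p₁<)
  , inj₂ (a₂ , b₂ , a₂∈ , b₂∈ , 0≤a₂ , 0≤b₂ , p₂<) , q≤) =
  -- The larger of `a₁` and `a₂` serves as common factor: `b₁` and `b₂` are non-negative, so
  -- enlarging the factor keeps both bounds.
  let a , a∈ , a₁≤a , a₂≤a = upper
      p₁<ab₁ = ℚₚ.<-≤-trans p₁< (*-mono-≤-nonNeg 0≤a₁ 0≤b₁ a₁≤a (ℚₚ.≤-refl {b₁}))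
      p₂<ab₂ = ℚₚ.<-≤-trans p₂< (*-mono-≤-nonNeg 0≤a₂ 0≤b₂ a₂≤a (ℚₚ.≤-refl {b₂}))
  in  inj₂ (a , b₁ ℚ.+ b₂ , a∈ , (b₁ , b₂ , b₁∈ , b₂∈ , ℚₚ.≤-refl) ,
        ℚₚ.≤-trans 0≤a₁ a₁≤a , ℚₚ.+-mono-≤ 0≤b₁ 0≤b₂ ,
        ℚₚ.≤-<-trans q≤ (subst (p₁ ℚ.+ p₂ ℚ.<_) (sym (ℚₚ.*-distribˡ-+ a b₁ b₂))
          (ℚₚ.+-mono-< p₁<ab₁ p₂<ab₂)))
  where
  upper : ∃[ a ] below t a × a₁ ℚ.≤ a × a₂ ℚ.≤ a
  upper with ℚₚ.≤-total a₁ a₂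
  ... | inj₁ a₁≤a₂ = a₂ , a₂∈ , a₁≤a₂ , ℚₚ.≤-refl
  ... | inj₂ a₂≤a₁ = a₁ , a₁∈ , ℚₚ.≤-refl , a₂≤a₁

-- Locating finite cuts, and cancellation

module Classical (em : ExcludedMiddle 0ℓ) where

  -- Halving a gap of length 2ᵏ e between a member and a non-member k times.
  finite-gap : ∀ x → Finite x → ∀ e → 0ℚ ℚ.< e → ∃[ p ] below x p × ¬ below x (p ℚ.+ e)
  finite-gap x (b , b∉) e 0<e =
    let k , b+1<2^k*e = archimedean (b ℚ.+ 1ℚ) e 0<e
        b<2^k*e-1 = +-cancelʳ-< 1ℚ (subst (b ℚ.+ 1ℚ ℚ.<_) (p≡p-q+q (2^ k ℚ.* e) 1ℚ) b+1<2^k*e)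
    in  halve k (ℚ.- 1ℚ , negative x (ℚₚ.negative⁻¹ (ℚ.- 1ℚ)) ,
          λ q∈ → b∉ (down x b<2^k*e-1 (subst (below x) (ℚₚ.+-comm (ℚ.- 1ℚ) (2^ k ℚ.* e)) q∈)))
    where
    Gap : ℚ → Set
    Gap g = ∃[ p ] below x p × ¬ below x (p ℚ.+ g)
    halve : ∀ k → Gap (2^ k ℚ.* e) → Gap e
    halve zero = subst Gap (ℚₚ.*-identityˡ e)
    halve (suc k) (p , p∈ , p∉) with em {below x (p ℚ.+ 2^ k ℚ.* e)}
    ... | no mid∉  = halve k (p , p∈ , mid∉)
    ... | yes mid∈ = halve k (p ℚ.+ 2^ k ℚ.* e , mid∈ , p∉ ∘ subst (below x)
            (solve 3 (λ p r e → (p :+ r :* e) :+ r :* e := p :+ (r :+ r) :* e) refl p (2^ k) e))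

  -- A finite `x` can be located up to the slack `q′ - q`: members `a` of `x` satisfy a < p + (q′ -
  -- q). Hence a + q < p + q′ ≤ a + b, so q < b.
  +-cancelˡ-≤ : ∀ x y z → Finite x → x + y ≤ x + z → y ≤ z
  +-cancelˡ-≤ x y z fin x+y≤x+z q q∈ =
    let q′ , q<q′ , q′∈ = open′ y q∈
        p , p∈ , p∉ = finite-gap x fin (q′ ℚ.- q) (p<q⇒0<q-p q q′ q<q′)
        a , b , a∈ , b∈ , p+q′≤a+b = x+y≤x+z (p ℚ.+ q′) (p , q′ , p∈ , q′∈ , ℚₚ.≤-refl)
        a+q<p+q′ = subst (a ℚ.+ q ℚ.<_)
                     (solve 3 (λ p q q′ → (p :+ (q′ :- q)) :+ q := p :+ q′) refl p q q′)
                     (ℚₚ.+-monoˡ-< q (below⇒< x a∈ p∉))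
        q+a<b+a = subst₂ ℚ._<_ (ℚₚ.+-comm a q) (ℚₚ.+-comm a b) (ℚₚ.<-≤-trans a+q<p+q′ p+q′≤a+b)
    in  down z (+-cancelʳ-< a q+a<b+a) b∈

-- Ascending sequences and suprema

Ascending : (ℕ → ℝ≥0∞) → Set
Ascending f = ∀ k → f k ≤ f (suc k)

ascending⇒mono : ∀ f → Ascending f → ∀ {i j} → i ℕ.≤ j → f i ≤ f j
ascending⇒mono f f↑ i≤j = go (ℕₚ.≤⇒≤′ i≤j)
  where
  go : ∀ {i j} → i ℕ.≤′ j → f i ≤ f j
  go (ℕ.≤′-reflexive refl) q q∈ = q∈
  go (ℕ.≤′-step i≤′j) q q∈ = f↑ _ q (go i≤′j q q∈)

⨆ : (ℕ → ℝ≥0∞) → ℝ≥0∞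
⨆ f .below q = ∃[ k ] below (f k) q
⨆ f .negative q<0 = 0 , negative (f 0) q<0
⨆ f .down p<q (k , q∈) = k , down (f k) p<q q∈
⨆ f .open′ (k , p∈) = let q , p<q , q∈ = open′ (f k) p∈ in q , p<q , k , q∈

contraction∞ : ℕ → ℝ≥0∞
contraction∞ k = fromℚ (contraction k) {{contraction-nonNegative k}}

2^∞ : ℕ → ℝ≥0∞
2^∞ k = fromℚ (2^ k) {{2^-nonNegative k}}

contraction∞-ascending : Ascending contraction∞
contraction∞-ascending k _ q<c = ℚₚ.<-≤-trans q<c (contraction-ascending k)

-- So `x` is the supremum of the products cₖ x, even for x = ∞. For q < p < q′ with `q′` below `x`,
-- some `k` has p < cₖ q′; then a = p / q′ lies below cₖ, and a q′ = p exceeds `q`.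
below-contraction : ∀ x q → below x q → ∃[ k ] below (contraction∞ k * x) q
below-contraction x q q∈ with q ℚₚ.<? 0ℚ
... | yes q<0 = 0 , inj₁ q<0
... | no q≮0 =
  let q′ , q<q′ , q′∈ = open′ x q∈
      p , q<p , p<q′ = ℚₚ.<-dense q<q′
      0≤q = ℚₚ.≮⇒≥ q≮0
      0<p = ℚₚ.≤-<-trans 0≤q q<p
      0<q′ = ℚₚ.<-trans 0<p p<q′
      instance
        q′>0 = ℚ.positive 0<q′
        q′≥0 = ℚₚ.pos⇒nonNeg q′
        q′≢0 = ℚₚ.pos⇒nonZero q′
      k , p<c*q′ = contraction-dense p q′ 0<q′ p<q′
      a = p ℚ.* ℚ.1/ q′
      a*q′≡p = trans (ℚₚ.*-assoc p (ℚ.1/ q′) q′)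
              (trans (cong (p ℚ.*_) (ℚₚ.*-inverseˡ q′)) (ℚₚ.*-identityʳ p))
      a<c = ℚₚ.*-cancelʳ-<-nonNeg q′ (subst (ℚ._< contraction k ℚ.* q′) (sym a*q′≡p) p<c*q′)
      0<a = ℚₚ.*-cancelʳ-<-nonNeg q′
              (subst₂ ℚ._<_ (sym (ℚₚ.*-zeroˡ q′)) (sym a*q′≡p) 0<p)
  in  k , inj₂ (a , q′ , a<c , q′∈ , ℚₚ.<⇒≤ 0<a , ℚₚ.<⇒≤ 0<q′ , subst (q ℚ.<_) (sym a*q′≡p) q<p)

-- Monotonicity and ω-continuity of formulas

module Formulas {a ℓ : Level} {n : ℕ} {D : Fin n → Set a} (L : Language D ℓ) where
  open Language L
  open Systems L

  private variable
    i : Fin n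
    η θ : 𝔼 ∐D

  monotone : (F : Formula i) → η ⊑ θ → ⟦ F ⟧ᶠ η ⊑ ⟦ F ⟧ᶠ θ
  monotone (call j e) η⊑θ v = η⊑θ (j , expr e v)
  monotone ⌜ t ⌝ η⊑θ v q q∈ = q∈
  monotone {η = η} {θ} (F ⊞ G) η⊑θ v =
    +-mono (⟦ F ⟧ᶠ η v) (⟦ F ⟧ᶠ θ v) (⟦ G ⟧ᶠ η v) (⟦ G ⟧ᶠ θ v) (monotone F η⊑θ v) (monotone G η⊑θ v)
  monotone {η = η} {θ} (t ⊡ F) η⊑θ v =
    *-mono τ τ (⟦ F ⟧ᶠ η v) (⟦ F ⟧ᶠ θ v) (λ _ a∈ → a∈) (monotone F η⊑θ v)
    where τ = proj₁ (term t v)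
  monotone (cond φ F G) η⊑θ v with test φ v
  ... | true  = monotone F η⊑θ v
  ... | false = monotone G η⊑θ v

  -- A rational below the value depends on finitely many rationals below the arguments, each reached
  -- at some stage. A sum joins the stages of its summands by their maximum.
  continuous : (F : Formula i) (x : ℕ → 𝔼 ∐D) → (∀ k → x k ⊑ x (suc k)) →
               ∀ v → ⟦ F ⟧ᶠ (λ d → ⨆ (λ k → x k d)) v ≤ ⨆ (λ k → ⟦ F ⟧ᶠ (x k) v)
  continuous (call j e) x x↑ v q q∈ = q∈
  continuous ⌜ t ⌝ x x↑ v q q∈ = 0 , q∈
  continuous (F ⊞ G) x x↑ v q (a , b , a∈ , b∈ , q≤) =
    let j , a∈Fj = continuous F x x↑ v a a∈
        k , b∈Gk = continuous G x x↑ v b b∈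
    in  j ℕ.⊔ k , a , b ,
        ascending⇒mono (λ k → ⟦ F ⟧ᶠ (x k) v) (λ k → monotone F (x↑ k) v) (ℕₚ.m≤m⊔n j k) a a∈Fj ,
        ascending⇒mono (λ k → ⟦ G ⟧ᶠ (x k) v) (λ k → monotone G (x↑ k) v) (ℕₚ.m≤n⊔m j k) b b∈Gk ,
        q≤
  continuous (t ⊡ F) x x↑ v q (inj₁ q<0) = 0 , inj₁ q<0
  continuous (t ⊡ F) x x↑ v q (inj₂ (a , b , a∈ , b∈ , rest)) =
    let k , b∈Fk = continuous F x x↑ v b b∈ in k , inj₂ (a , b , a∈ , b∈Fk , rest)
  continuous (cond φ F G) x x↑ v with test φ v
  ... | true  = continuous F x x↑ v
  ... | false = continuous G x x↑ v

  -- Affine decomposition of formulas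

  -- The linear part, which will serve as the value of 𝖣. Subtraction is given only by its graph, so
  -- this value is built by recursion on the formula.
  ⟦_⟧ˡ : Formula i → 𝔼 ∐D → 𝔼 (D i)
  ⟦ call j e ⟧ˡ   η v = η (j , expr e v)
  ⟦ ⌜ t ⌝ ⟧ˡ      η v = 𝟎
  ⟦ F ⊞ G ⟧ˡ      η v = ⟦ F ⟧ˡ η v + ⟦ G ⟧ˡ η v
  ⟦ t ⊡ F ⟧ˡ      η v = proj₁ (term t v) * ⟦ F ⟧ˡ η v
  ⟦ cond φ F G ⟧ˡ η v = if test φ v then ⟦ F ⟧ˡ η v else ⟦ G ⟧ˡ η v

  -- Together with `affine-≥`, this makes the linear part a solution z of F(η) = F(𝕆) + z. Sums use
  -- interchange, scalar products distributivity.
  affine-≤ : (F : Formula i) (η : 𝔼 ∐D) → ⟦ F ⟧ᶠ η ⊑ ⟦ F ⟧ᶠ 𝕆 ∔ ⟦ F ⟧ˡ η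
  affine-≤ (call j e) η v = x≤y+x (η (j , expr e v)) 𝟎
  affine-≤ ⌜ t ⌝ η v = x≤x+y (proj₁ (term t v)) 𝟎
  affine-≤ (F ⊞ G) η v q (a , b , a∈ , b∈ , q≤) =
    +-interchange-≤ (⟦ F ⟧ᶠ 𝕆 v) (⟦ F ⟧ˡ η v) (⟦ G ⟧ᶠ 𝕆 v) (⟦ G ⟧ˡ η v) q
      (a , b , affine-≤ F η v a a∈ , affine-≤ G η v b b∈ , q≤)
  affine-≤ (t ⊡ F) η v q q∈ =
    *-distribˡ-+-≤ τ (⟦ F ⟧ᶠ 𝕆 v) (⟦ F ⟧ˡ η v) q
      (*-mono τ τ (⟦ F ⟧ᶠ η v) (⟦ F ⟧ᶠ 𝕆 v + ⟦ F ⟧ˡ η v) (λ _ a∈ → a∈) (affine-≤ F η v) q q∈)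
    where τ = proj₁ (term t v)
  affine-≤ (cond φ F G) η v with test φ v
  ... | true  = affine-≤ F η v
  ... | false = affine-≤ G η v

  affine-≥ : (F : Formula i) (η : 𝔼 ∐D) → ⟦ F ⟧ᶠ 𝕆 ∔ ⟦ F ⟧ˡ η ⊑ ⟦ F ⟧ᶠ η
  affine-≥ (call j e) η v = 𝟎+x≤x (η (j , expr e v))
  affine-≥ ⌜ t ⌝ η v = x+𝟎≤x (proj₁ (term t v))
  affine-≥ (F ⊞ G) η v q q∈ =
    +-mono (⟦ F ⟧ᶠ 𝕆 v + ⟦ F ⟧ˡ η v) (⟦ F ⟧ᶠ η v) (⟦ G ⟧ᶠ 𝕆 v + ⟦ G ⟧ˡ η v) (⟦ G ⟧ᶠ η v)
      (affine-≥ F η v) (affine-≥ G η v) q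
      (+-interchange-≤ (⟦ F ⟧ᶠ 𝕆 v) (⟦ G ⟧ᶠ 𝕆 v) (⟦ F ⟧ˡ η v) (⟦ G ⟧ˡ η v) q q∈)
  affine-≥ (t ⊡ F) η v q q∈ =
    *-mono τ τ (⟦ F ⟧ᶠ 𝕆 v + ⟦ F ⟧ˡ η v) (⟦ F ⟧ᶠ η v) (λ _ a∈ → a∈) (affine-≥ F η v) q
      (*-distribˡ-+-≥ τ (⟦ F ⟧ᶠ 𝕆 v) (⟦ F ⟧ˡ η v) q q∈)
    where τ = proj₁ (term t v)
  affine-≥ (cond φ F G) η v with test φ v
  ... | true  = affine-≥ F η v
  ... | false = affine-≥ G η v

  linear-mono : (F : Formula i) → η ⊑ θ → ⟦ F ⟧ˡ η ⊑ ⟦ F ⟧ˡ θ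
  linear-mono (call j e) η⊑θ v = η⊑θ (j , expr e v)
  linear-mono ⌜ t ⌝ η⊑θ v q q∈ = q∈
  linear-mono {η = η} {θ} (F ⊞ G) η⊑θ v =
    +-mono (⟦ F ⟧ˡ η v) (⟦ F ⟧ˡ θ v) (⟦ G ⟧ˡ η v) (⟦ G ⟧ˡ θ v)
      (linear-mono F η⊑θ v) (linear-mono G η⊑θ v)
  linear-mono {η = η} {θ} (t ⊡ F) η⊑θ v =
    *-mono τ τ (⟦ F ⟧ˡ η v) (⟦ F ⟧ˡ θ v) (λ _ a∈ → a∈) (linear-mono F η⊑θ v)
    where τ = proj₁ (term t v)
  linear-mono (cond φ F G) η⊑θ v with test φ v
  ... | true  = linear-mono F η⊑θ v
  ... | false = linear-mono G η⊑θ v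

  linear-subadditive : (F : Formula i) (η θ : 𝔼 ∐D) → ⟦ F ⟧ˡ (η ∔ θ) ⊑ ⟦ F ⟧ˡ η ∔ ⟦ F ⟧ˡ θ
  linear-subadditive (call j e) η θ v q q∈ = q∈
  linear-subadditive ⌜ t ⌝ η θ v = 𝟎-least (𝟎 + 𝟎)
  linear-subadditive (F ⊞ G) η θ v q (a , b , a∈ , b∈ , q≤) =
    +-interchange-≤ (⟦ F ⟧ˡ η v) (⟦ F ⟧ˡ θ v) (⟦ G ⟧ˡ η v) (⟦ G ⟧ˡ θ v) q
      (a , b , linear-subadditive F η θ v a a∈ , linear-subadditive G η θ v b b∈ , q≤)
  linear-subadditive (t ⊡ F) η θ v q q∈ =
    *-distribˡ-+-≤ τ (⟦ F ⟧ˡ η v) (⟦ F ⟧ˡ θ v) q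
      (*-mono τ τ (⟦ F ⟧ˡ (η ∔ θ) v) (⟦ F ⟧ˡ η v + ⟦ F ⟧ˡ θ v) (λ _ a∈ → a∈)
        (linear-subadditive F η θ v) q q∈)
    where τ = proj₁ (term t v)
  linear-subadditive (cond φ F G) η θ v with test φ v
  ... | true  = linear-subadditive F η θ v
  ... | false = linear-subadditive G η θ v

  -- For the constant 1, the linear part is a summand of `⟦ F ⟧ᶠ 𝟙 v`. Subadditivity then carries
  -- the bound from 2ᵏ to its double, which is why the constants are powers of two.
  linear-2^ : (F : Formula i) (v : D i) → ⟦ F ⟧ᶠ 𝟙 v ≤ 𝟏 →
              ∀ k → ⟦ F ⟧ˡ (λ _ → 2^∞ k) v ≤ 2^∞ k
  linear-2^ F v F𝟙≤1 zero q q∈ =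
    F𝟙≤1 q (affine-≥ F 𝟙 v q (x≤y+x (⟦ F ⟧ˡ 𝟙 v) (⟦ F ⟧ᶠ 𝕆 v) q q∈))
  linear-2^ F v F𝟙≤1 (suc k) q q∈ =
    let instance
          2^k≥0   = 2^-nonNegative k
          2^1+k≥0 = 2^-nonNegative (suc k)
        c = λ (_ : ∐D) → 2^∞ k
        a , b , a∈ , b∈ , q≤ = linear-subadditive F c c v q
          (linear-mono {θ = c ∔ c} F (λ _ → fromℚ-+-≥ (2^ k) (2^ k) (2^ (suc k)) refl) v q q∈)
    in  fromℚ-+-≤ (2^ k) (2^ k) (2^ (suc k)) refl q
          (a , b , linear-2^ F v F𝟙≤1 k a a∈ , linear-2^ F v F𝟙≤1 k b b∈ , q≤)

  -- Scaled systems and their iterates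

  module _ (E : System) where

    scaled : ℕ → System
    scaled k i = const (contraction k) {{contraction-nonNegative k}} ⊡ E i

    scaled-≤ : ∀ k η → ⟦ scaled k ⟧ η ⊑ ⟦ E ⟧ η
    scaled-≤ k η (i , v) = ≤𝟏⇒*-≤ (proj₁ (term {i} (const c) v)) (⟦ E i ⟧ᶠ η v)
      (λ q q∈ → fromℚ-mono c 1ℚ (contraction≤1 k) q (proj₁ (const-≈ c v) q q∈))
      where
      c = contraction k
      instance c≥0 = contraction-nonNegative k

    contraction-≤-scaled : ∀ k η d → contraction∞ k * ⟦ E ⟧ η d ≤ ⟦ scaled k ⟧ η d
    contraction-≤-scaled k η (i , v) = *-mono (contraction∞ k) (proj₁ (term {i} (const c) v))
      (⟦ E i ⟧ᶠ η v) (⟦ E i ⟧ᶠ η v) (proj₂ (const-≈ c v)) (λ _ q∈ → q∈)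
      where
      c = contraction k
      instance c≥0 = contraction-nonNegative k

    scaled-ascending : ∀ k η → ⟦ scaled k ⟧ η ⊑ ⟦ scaled (suc k) ⟧ η
    scaled-ascending k η (i , v) = *-mono
      (proj₁ (term {i} (const c) v)) (proj₁ (term {i} (const c′) v)) (⟦ E i ⟧ᶠ η v) (⟦ E i ⟧ᶠ η v)
      (λ q q∈ → proj₂ (const-≈ c′ v) q (contraction∞-ascending k q (proj₁ (const-≈ c v) q q∈)))
      (λ _ q∈ → q∈)
      where
      c  = contraction k
      c′ = contraction (suc k)
      instance
        c≥0  = contraction-nonNegative k
        c′≥0 = contraction-nonNegative (suc k)

    -- The first index selects the scaled system, the second counts applications; the sequence
    -- ascends in each separately.
    iterate : ℕ → ℕ → 𝔼 ∐D
    iterate k zero    = 𝕆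
    iterate k (suc l) = ⟦ scaled k ⟧ (iterate k l)

    iterate-postfixed : ∀ k l → iterate k l ⊑ iterate k (suc l)
    iterate-postfixed k zero    d       = 𝟎-least (iterate k 1 d)
    iterate-postfixed k (suc l) (i , v) = monotone (scaled k i) (iterate-postfixed k l) v

    iterate-ascending : ∀ k l → iterate k l ⊑ iterate (suc k) l
    iterate-ascending k zero    d q q∈ = q∈
    iterate-ascending k (suc l) d@(i , v) q q∈ =
      scaled-ascending k (iterate (suc k) l) d q (monotone (scaled k i) (iterate-ascending k l) v q q∈)

    -- With θ = 𝟙 this bounds the iterates by `u`; with θ the least fixed point it gives the upper
    -- bound on η′.
    iterate-≤-prefixed : ∀ θ → ⟦ E ⟧ θ ⊑ θ → ∀ k l → iterate k l ⊑ θ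
    iterate-≤-prefixed θ Eθ⊑θ k zero    d = 𝟎-least (θ d)
    iterate-≤-prefixed θ Eθ⊑θ k (suc l) d@(i , v) q q∈ =
      Eθ⊑θ d q (monotone (E i) (iterate-≤-prefixed θ Eθ⊑θ k l) v q
        (scaled-≤ k (iterate k l) d q q∈))

    diagonal : ℕ → 𝔼 ∐D
    diagonal k = iterate k k

    diagonal-ascending : ∀ k → diagonal k ⊑ diagonal (suc k)
    diagonal-ascending k d q q∈ = iterate-ascending k (suc k) d q (iterate-postfixed k k d q q∈)

    limit : 𝔼 ∐D
    limit d = ⨆ (λ k → diagonal k d)

    limit-postfixed : limit ⊑ ⟦ E ⟧ limit
    limit-postfixed d@(i , v) q (k , q∈) =
      monotone {η = diagonal k} (E i) (λ _ p p∈ → k , p∈) v q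
        (scaled-≤ k (diagonal k) d q (iterate-postfixed k k d q q∈))

    -- Continuity replaces the limit by some xⱼ, and `below-contraction` inserts a factor cₖ. Both
    -- indices are then raised to their maximum `l`.
    limit-prefixed : ⟦ E ⟧ limit ⊑ limit
    limit-prefixed d@(i , v) q q∈ =
      let j , q∈Exⱼ = continuous (E i) diagonal diagonal-ascending v q q∈
          k , q∈cₖExⱼ = below-contraction (⟦ E ⟧ (diagonal j) d) q q∈Exⱼ
          l = j ℕ.⊔ k
          xⱼ≤xₗ = λ d → ascending⇒mono (λ k → diagonal k d) (λ k → diagonal-ascending k d) (ℕₚ.m≤m⊔n j k)
          cₖ≤cₗ = ascending⇒mono contraction∞ contraction∞-ascending (ℕₚ.m≤n⊔m j k)
          q∈cₗExₗ = *-mono (contraction∞ k) (contraction∞ l) (⟦ E ⟧ (diagonal j) d) (⟦ E ⟧ (diagonal l) d)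
                      cₖ≤cₗ (monotone {η = diagonal j} (E i) xⱼ≤xₗ v) q q∈cₖExⱼ
      -- Applying the system scaled by cₗ to `diagonal l` gives `iterate l (suc l)`; raising the
      -- first index puts it below `diagonal (suc l)`.
      in  suc l , iterate-ascending l (suc l) d q
            (contraction-≤-scaled l (diagonal l) d q q∈cₗExₗ)

    -- Provability of the diagonal iterates

    module _ (em : ExcludedMiddle 0ℓ) (E≤1 : Restricts ⟦ E ⟧) where
      open Classical em

      diagonal-provable : ∀ k → Provable E (diagonal k)
      diagonal-provable k = record
        { E′        = scaled k
        ; E′≤E      = scaled-≤ k
        ; u         = 𝟙
        ; prefixed  = λ d q q∈ → E𝟙⊑𝟙 d q (scaled-≤ k 𝟙 d q q∈)
        ; r         = λ _ → 2^∞ k , fromℚ-finite (2^ k) {{2^-nonNegative k}}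
        ; ranking   = δ , differential , decreasing
        ; η′≤u      = iterate-≤-prefixed 𝟙 E𝟙⊑𝟙 k k
        ; postfixed = iterate-postfixed k k
        }
        where
        c = contraction k
        instance
          c≥0 = contraction-nonNegative k
          r≥0 = 2^-nonNegative k
          c*r≥0 : NonNegative (c ℚ.* 2^ k)
          c*r≥0 = ℚ.nonNegative (*-mono-≤-nonNeg ℚₚ.≤-refl (ℚₚ.nonNegative⁻¹ (2^ k))
                                   (ℚₚ.nonNegative⁻¹ c) (ℚₚ.nonNegative⁻¹ (2^ k)))
        E𝟙⊑𝟙 = E≤1 𝟙 (λ _ _ q∈ → q∈)
        r : 𝔼 ∐D
        r _ = 2^∞ k
        δ : 𝔼 ∐D
        δ (i , v) = ⟦ scaled k i ⟧ˡ r v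
        -- Finiteness licenses the cancellation of the value at `𝕆`, which is bounded by 1.
        𝕆-finite : ∀ d → Finite (⟦ scaled k ⟧ 𝕆 d)
        𝕆-finite d = 1ℚ , λ 1∈ → ℚₚ.<-irrefl refl
          (E≤1 𝕆 (λ _ → 𝟎-least 𝟏) d 1ℚ (scaled-≤ k 𝕆 d 1ℚ 1∈))
        differential : IsDifferential ⟦ scaled k ⟧ r δ
        differential d@(i , v) = (affine-≤ (scaled k i) r v , affine-≥ (scaled k i) r v) ,
          -- Minimality: K(𝕆) + δ ≤ K(r) ≤ K(𝕆) + z, and K(𝕆) cancels.
          λ z (Kr≤K𝕆+z , _) → +-cancelˡ-≤ (⟦ scaled k ⟧ 𝕆 d) (δ d) z (𝕆-finite d)
            (λ q q∈ → Kr≤K𝕆+z q (affine-≥ (scaled k i) r v q q∈))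
        decreasing : δ ∔ 𝟙 ⊑ r
        decreasing (i , v) q (a , b , a∈ , b<1 , q≤) =
          -- The linear part of the scaled formula is cₖ times that of `E i`, hence at most cₖ 2ᵏ;
          -- adding u = 1 gives 2ᵏ.
          fromℚ-+-≤ (c ℚ.* 2^ k) 1ℚ (2^ k) (contraction-2^ k) q
            ( a , b
            , fromℚ-*-≤ c (2^ k) (c ℚ.* 2^ k) refl a
                (*-mono (proj₁ (term {i} (const c) v)) (fromℚ c) (⟦ E i ⟧ˡ r v) (2^∞ k)
                  (proj₁ (const-≈ c v)) (linear-2^ (E i) v (E𝟙⊑𝟙 (i , v)) k) a a∈)
            , b<1 , q≤)

-- Approximation of the least fixed point

theorem4p9 : ExcludedMiddle 0ℓ →
    {a ℓ : Level} {n : ℕ} {D : Fin n → Set a} (L : Language D ℓ) →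
    let open Systems L in
    (E : System) (E≤1 : Restricts ⟦ E ⟧) →
    (m : 𝔼≤1 ∐D) → IsLeastFixedPoint _⊑₁_ (restrict ⟦ E ⟧ E≤1) m →
    (d : ∐D) (ε : ℝ≥0) → 𝟎 < proj₁ ε →
    Σ[ η′ ∈ 𝔼 ∐D ]
    (proj₁ m d < η′ d + proj₁ ε) × (η′ d ≤ proj₁ m d) × Provable E η′
theorem4p9 em L E E≤1 (m , m⊑𝟙) lfp d (ε , _) (e , e∈ε , e≮0) =
  -- The given `e` may be 0; openness yields a strictly positive `e′` still below ε.
  let e′ , e<e′ , e′∈ε = open′ ε e∈ε
      m-finite = 1ℚ , λ 1∈ → ℚₚ.<-irrefl refl (m⊑𝟙 d 1ℚ 1∈)
      -- The gap makes p + e′ the rational witnessing strictness: it is not below `m d`, but it is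
      -- below xₖ + ε once `p` is below xₖ.
      p , p∈m , p+e′∉m = finite-gap (m d) m-finite e′ (ℚₚ.≤-<-trans (ℚₚ.≮⇒≥ e≮0) e<e′)
      k , p∈xₖ = m⊑limit d p p∈m
  in  diagonal E k
    , (p ℚ.+ e′ , (p , e′ , p∈xₖ , e′∈ε , ℚₚ.≤-refl) , p+e′∉m)
    , iterate-≤-prefixed E m (proj₁ fixed) k k d
    , diagonal-provable E em E≤1 k
  where
  open Classical em
  open Formulas L
  open IsLeastFixedPoint lfp
  E𝟙⊑𝟙 = E≤1 𝟙 (λ _ _ q∈ → q∈)
  m⊑limit : m ⊑ limit E
  -- Leastness is relative to 𝔼≤1, so the limit must first be bounded by the prefixed point `𝟙`.
  m⊑limit = least
    (limit E , λ d q (k , q∈) → iterate-≤-prefixed E 𝟙 E𝟙⊑𝟙 k k d q q∈)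
    (limit-prefixed E , limit-postfixed E)
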